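{- Let $\mathcal{B}$ be the set of all $\beta(1,0)$-trees and let $h:\mathcal{B}\to\mathcal{B}$ be the involution defined recursively by $h(\bullet)=\bullet$, $h(\lambda_i t)=\gamma_i h(t)$ for $t\in\mathcal{B}$ and $1\le i\le \operatorname{root} t$, and $h(u\oplus v)=h(v)\oslash h(u)$ for $u,v\in\mathcal{B}\setminus\{\bullet\}$. Then $h$ sends the tuple of statistics $(\mathrm{leaves},\mathrm{int},\mathrm{root},\mathrm{rpath},\mathrm{sub},\mathrm{rsub})$ to $(\mathrm{int},\mathrm{leaves},\mathrm{rpath},\mathrm{root},\mathrm{rsub},\mathrm{sub})$ on trees with at least one edge; that is, for every $\beta(1,0)$-tree $t$ with at least one edge, $$\mathrm{leaves}\,t=\mathrm{int}\,h(t),\quad \mathrm{int}\,t=\mathrm{leaves}\,h(t),\quad \mathrm{root}\,t=\mathrm{rpath}\,h(t),$$ $$\mathrm{rpath}\,t=\mathrm{root}\,h(t),\quad \mathrm{sub}\,t=\mathrm{rsub}\,h(t),\quad \mathrm{rsub}\,t=\mathrm{sub}\,h(t).$$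
   Context: A $\beta(1,0)$-tree is a rooted plane tree (children of each node are linearly ordered left to right) whose nodes are labeled with positive integers such that: (1) leaves have label $1$; (2) the root has label equal to the sum of its children's labels; (3) any other non-leaf node has label no greater than the sum of its children's labels. The single-node tree, whose only node has label $1$, is a $\beta(1,0)$-tree and is denoted $\bullet$ (it is exempt from (2)). $\mathcal{B}$ is the set of all $\beta(1,0)$-trees. Statistics of a $\beta(1,0)$-tree $t$: $\mathrm{root}\,t$ is the label of the root; the right path of $t$ is the path from the root to the rightmost leaf (always go to the last child), and $\mathrm{rpath}\,t$ is its number of edges; $\mathrm{leaves}\,t$ is the number of leaves; $\mathrm{int}\,t$ is the number of internal (non-leaf) nodes, the root included; $\mathrm{sub}\,t$ is the number of children of the root; $\mathrm{rsub}\,t$ is the number of nodes labeled $1$ on the right path strictly below the root (the rightmost leaf is counted). Operations: - For $u,v\in\mathcal{B}\setminus\{\bullet\}$, $u\oplus v$ is the tree obtained by identifying the roots: its root label is $\operatorname{root} u+\operatorname{root} v$, and the subtrees at its root are those of $u$ followed by those of $v$. - For $t\in\mathcal{B}$ and $1\le i\le\operatorname{root} t$, $\lambda_i t$ is obtained from $t$ by adding a new root whose only child is the old root; both the new root and the old root are assigned the label $i$. - For $u,v\in\mathcal{B}\setminus\{\bullet\}$, $u\oslash v$ is obtained by identifying the rightmost leaf of $u$ with the root of $v$; the identified node gets label $1$, and all other labels are kept. - For $t\in\mathcal{B}\setminus\{\bullet\}$ and $1\le i\le \operatorname{rpath} t$, let $x$ be the $i$th node on the right path of $t$ (the root being the first).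 Then $\gamma_i t$ is obtained by attaching to $x$ a new leaf (label $1$) as the new last child of $x$, and adding $1$ to the label of each node on the path from the root to $x$ (inclusive). By convention $\gamma_1\bullet$ is the tree with two nodes, both labeled $1$. The operations $\oplus$ and $\oslash$ are associative. Every $\beta(1,0)$-tree is of exactly one of the forms $\bullet$; $\lambda_i u$ with $u\in\mathcal{B}$, $1\le i\le\operatorname{root}u$ (root has exactly one child; $i$ and $u$ are then unique); $u\oplus v$ with $u,v\neq\bullet$ (root has at least two children; the decomposition into a sum of trees of the form $\lambda_i u$ is unique). Hence the recursion determines $h$ (the well-definedness of $\gamma_i h(t)$ for $t\neq\bullet$ uses $\operatorname{rpath} h(t)=\operatorname{root} t$, established along the same recursion). -}

module Defs where

open import Data.Nat using (ℕ; zero; suc; pred; _+_; _≤_; _<_; z≤n; s≤s; _≟_)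
open import Data.Nat.Properties
open import Data.List using (List; []; _∷_; _++_; _∷ʳ_; map; length; filter)
open import Data.List.Properties using (map-++)
open import Data.Nat.ListAction using (sum)
open import Data.Nat.ListAction.Properties using (sum-++)
open import Data.List.Relation.Unary.All using (All; []; _∷_)
open import Data.List.Relation.Unary.All.Properties using (++⁺)
open import Data.Product using (Σ; _×_; _,_)
open import Data.Empty using (⊥-elim)
open import Relation.Binary.PropositionalEquality
  using (_≡_; _≢_; refl; sym; trans; cong; cong₂; subst)

-- Arbitrary ℕ-labelled plane trees.  The operations are total here; outside the
-- domains stated for β(1,0)-trees below, their values are irrelevant.

module Raw where

  data Tree : Set where
    node : (label : ℕ) (children : List Tree) → Tree

  label : Tree → ℕ
  label (node a _) = a

  children : Tree → List Tree
  children (node _ ts) = ts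

  labelSum : List Tree → ℕ
  labelSum ts = sum (map label ts)

  • : Tree
  • = node 1 []

  -- The condition on a tree hanging below the root of a β(1,0)-tree.
  data IsSubtree : Tree → Set where
    leaf  : IsSubtree (node 1 [])
    inner : ∀ {a t ts} → 1 ≤ a → a ≤ labelSum (t ∷ ts) →
            All IsSubtree (t ∷ ts) → IsSubtree (node a (t ∷ ts))

  -- Positivity of the root label follows from that of the labels below it.
  data IsBeta : Tree → Set where
    single : IsBeta (node 1 [])
    root   : ∀ {a t ts} → a ≡ labelSum (t ∷ ts) →
             All IsSubtree (t ∷ ts) → IsBeta (node a (t ∷ ts))

  mutual
    leaves : Tree → ℕ
    leaves (node _ [])       = 1
    leaves (node _ (t ∷ ts)) = leavesF (t ∷ ts)

    leavesF : List Tree → ℕ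
    leavesF []       = 0
    leavesF (t ∷ ts) = leaves t + leavesF ts

  mutual
    int : Tree → ℕ
    int (node _ [])       = 0
    int (node _ (t ∷ ts)) = suc (intF (t ∷ ts))

    intF : List Tree → ℕ
    intF []       = 0
    intF (t ∷ ts) = int t + intF ts

  -- The labels met on the right path strictly below the root, given the
  -- subtrees at the root.
  rightLabels : List Tree → List ℕ
  rightLabels []               = []
  rightLabels (_ ∷ t ∷ ts)     = rightLabels (t ∷ ts)
  rightLabels (node a ts ∷ []) = a ∷ rightLabels ts

  rpath : Tree → ℕ
  rpath t = length (rightLabels (children t))

  sub : Tree → ℕ
  sub t = length (children t)

  rsub : Tree → ℕ
  rsub t = length (filter (_≟ 1) (rightLabels (children t)))

  infixr 6 _⊕_ _⊘_

  _⊕_ : Tree → Tree → Tree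
  node a ts ⊕ node b us = node (a + b) (ts ++ us)

  -- λᵢ
  lam : ℕ → Tree → Tree
  lam i t = node i (node i (children t) ∷ [])

  mutual
    _⊘_ : Tree → Tree → Tree
    node _ []       ⊘ v = node 1 (children v)
    node a (t ∷ ts) ⊘ v = node a (graftLast t ts v)

    graftLast : Tree → List Tree → Tree → List Tree
    graftLast t []       v = (t ⊘ v) ∷ []
    graftLast t (s ∷ ss) v = t ∷ graftLast s ss v

  -- attach k acts at the node of the right path that is k edges below the root.
  mutual
    attach : ℕ → Tree → Tree
    attach k (node a ts) = node (suc a) (attachF k ts)

    attachF : ℕ → List Tree → List Tree
    attachF zero    ts = ts ∷ʳ •
    attachF (suc k) ts = attachLast k ts

    attachLast : ℕ → List Tree → List Tree
    attachLast k []           = []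
    attachLast k (t ∷ [])     = attach k t ∷ []
    attachLast k (t ∷ s ∷ ss) = t ∷ attachLast k (s ∷ ss)

  -- γᵢ; the first clause is the convention for γ₁ •.
  gam : ℕ → Tree → Tree
  gam i (node _ [])       = node 1 (• ∷ [])
  gam i (node a (t ∷ ts)) = attach (pred i) (node a (t ∷ ts))

  data γ-Domain (i : ℕ) (t : Tree) : Set where
    convention : t ≡ • → i ≡ 1 → γ-Domain i t
    on-path    : t ≢ • → 1 ≤ i → i ≤ rpath t → γ-Domain i t

  -- The recursion for h, on the list of subtrees at the root: a β(1,0)-tree t
  -- is determined by this list, and a subtree with root label i and children ts
  -- is the summand λᵢ u of t where u has ts as its list of subtrees.
  hF : List Tree → Tree
  hF []                   = •
  hF (node i ts ∷ [])     = gam i (hF ts)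
  hF (node i ts ∷ u ∷ us) = hF (u ∷ us) ⊘ gam i (hF ts)

  mutual
    IsSubtree-irr : ∀ {t} (p q : IsSubtree t) → p ≡ q
    IsSubtree-irr leaf leaf = refl
    IsSubtree-irr (inner p q r) (inner p′ q′ r′)
      rewrite ≤-irrelevant p p′ | ≤-irrelevant q q′ | All-irr r r′ = refl

    All-irr : ∀ {ts} (p q : All IsSubtree ts) → p ≡ q
    All-irr []       []       = refl
    All-irr (p ∷ ps) (q ∷ qs) = cong₂ _∷_ (IsSubtree-irr p q) (All-irr ps qs)

  IsBeta-irr : ∀ {t} (p q : IsBeta t) → p ≡ q
  IsBeta-irr single single = refl
  IsBeta-irr (root p r) (root p′ r′)
    rewrite ≡-irrelevant p p′ | All-irr r r′ = refl

  subtrees : ∀ {t} → IsBeta t → All IsSubtree (children t)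
  subtrees single     = []
  subtrees (root _ r) = r

  labelSum-++ : ∀ ts us → labelSum (ts ++ us) ≡ labelSum ts + labelSum us
  labelSum-++ ts us =
    trans (cong sum (map-++ label ts us)) (sum-++ (map label ts) (map label us))

  label-pos : ∀ {t} → IsSubtree t → 1 ≤ label t
  label-pos leaf          = s≤s z≤n
  label-pos (inner p _ _) = p

  labelSum-pos : ∀ {t ts} → All IsSubtree (t ∷ ts) → 1 ≤ labelSum (t ∷ ts)
  labelSum-pos (p ∷ _) = ≤-trans (label-pos p) (m≤m+n _ _)

  lam-β : ∀ {t} i → 1 ≤ i → i ≤ label t → IsBeta t → IsBeta (lam i t)
  lam-β i 1≤i i≤ single with ≤-antisym i≤ 1≤i
  ... | refl = root refl (leaf ∷ [])
  lam-β i 1≤i i≤ (root refl r) =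
    root (sym (+-identityʳ i)) (inner 1≤i i≤ r ∷ [])

  ⊕-β : ∀ {u v} → u ≢ • → v ≢ • → IsBeta u → IsBeta v → IsBeta (u ⊕ v)
  ⊕-β u≢• _ single _ = ⊥-elim (u≢• refl)
  ⊕-β _ v≢• (root _ _) single = ⊥-elim (v≢• refl)
  ⊕-β _ _ (root {t = t} {ts} refl r) (root {t = u} {us} refl s) =
    root (sym (labelSum-++ (t ∷ ts) (u ∷ us))) (++⁺ r s)

  data NonEmpty : List Tree → Set where
    cons : ∀ {t ts} → NonEmpty (t ∷ ts)

  mkSubtree : ∀ {a ts} → NonEmpty ts → 1 ≤ a → a ≤ labelSum ts →
              All IsSubtree ts → IsSubtree (node a ts)
  mkSubtree cons = inner

  mkBeta : ∀ {a ts} → NonEmpty ts → a ≡ labelSum ts →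
           All IsSubtree ts → IsBeta (node a ts)
  mkBeta cons = root

  non-• : ∀ {t} → IsBeta t → t ≢ • → NonEmpty (children t)
  non-• single     t≢• = ⊥-elim (t≢• refl)
  non-• (root _ _) _   = cons

  graftLast-≢[] : ∀ t ts v → NonEmpty (graftLast t ts v)
  graftLast-≢[] t []       v = cons
  graftLast-≢[] t (_ ∷ _)  v = cons

  mutual
    ⊘-subtree : ∀ {t v} → NonEmpty (children v) → All IsSubtree (children v) →
                IsSubtree t → IsSubtree (t ⊘ v)
    ⊘-subtree {v = node _ (_ ∷ _)} cons s leaf = inner (s≤s z≤n) (labelSum-pos s) s
    ⊘-subtree {v = v} ne s (inner {t = t} {ts} p q r) =
      mkSubtree (graftLast-≢[] t ts v) p
        (subst (_ ≤_) (sym (graftLast-sum ne s r)) q) (graftLast-subtrees ne s r)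

    ⊘-label : ∀ {t v} → IsSubtree t → label (t ⊘ v) ≡ label t
    ⊘-label leaf          = refl
    ⊘-label (inner _ _ _) = refl

    graftLast-sum : ∀ {t ts v} → NonEmpty (children v) → All IsSubtree (children v) →
                    All IsSubtree (t ∷ ts) → labelSum (graftLast t ts v) ≡ labelSum (t ∷ ts)
    graftLast-sum _ _ (p ∷ [])             = cong (_+ 0) (⊘-label p)
    graftLast-sum {t} ne s (_ ∷ ps@(_ ∷ _)) = cong (label t +_) (graftLast-sum ne s ps)

    graftLast-subtrees : ∀ {t ts v} → NonEmpty (children v) → All IsSubtree (children v) →
                         All IsSubtree (t ∷ ts) → All IsSubtree (graftLast t ts v)
    graftLast-subtrees ne s (p ∷ [])         = ⊘-subtree ne s p ∷ []
    graftLast-subtrees ne s (p ∷ ps@(_ ∷ _)) = p ∷ graftLast-subtrees ne s ps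

  ⊘-β : ∀ {u v} → u ≢ • → v ≢ • → IsBeta u → IsBeta v → IsBeta (u ⊘ v)
  ⊘-β u≢• _ single _ = ⊥-elim (u≢• refl)
  ⊘-β {v = v} _ v≢• (root {t = t} {ts} e r) β =
    mkBeta (graftLast-≢[] t ts v)
      (trans e (sym (graftLast-sum (non-• β v≢•) (subtrees β) r)))
      (graftLast-subtrees (non-• β v≢•) (subtrees β) r)

  attachLast-≢[] : ∀ k t ts → NonEmpty (attachLast k (t ∷ ts))
  attachLast-≢[] k t []      = cons
  attachLast-≢[] k t (_ ∷ _) = cons

  attachF-≢[] : ∀ k {ts} → k < length (rightLabels ts) → NonEmpty (attachF k ts)
  attachF-≢[] k       {[]}     ()
  attachF-≢[] zero    {_ ∷ _}  _ = cons
  attachF-≢[] (suc k) {t ∷ ts} _ = attachLast-≢[] k t ts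

  attach-label : ∀ k t → label (attach k t) ≡ suc (label t)
  attach-label k (node _ _) = refl

  attachF-sum : ∀ k {ts} → k < length (rightLabels ts) →
                labelSum (attachF k ts) ≡ suc (labelSum ts)
  attachF-sum zero {ts} _ = trans (labelSum-++ ts (• ∷ [])) (+-comm (labelSum ts) 1)
  attachF-sum (suc k) {[]} ()
  attachF-sum (suc k) {t ∷ []} _ = cong (_+ 0) (attach-label k t)
  attachF-sum (suc k) {t ∷ s ∷ ss} k< =
    trans (cong (label t +_) (attachF-sum (suc k) {s ∷ ss} k<)) (+-suc (label t) _)

  attachF-subtrees : ∀ k {ts} → k < length (rightLabels ts) →
                     All IsSubtree ts → All IsSubtree (attachF k ts)
  attachF-subtrees zero _ r = ++⁺ r (leaf ∷ [])
  attachF-subtrees (suc k) () []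
  attachF-subtrees (suc k) (s≤s ()) (leaf ∷ [])
  attachF-subtrees (suc k) (s≤s k<) (inner p q r ∷ []) =
    mkSubtree (attachF-≢[] k k<) (s≤s z≤n)
      (subst (_ ≤_) (sym (attachF-sum k k<)) (s≤s q)) (attachF-subtrees k k< r) ∷ []
  attachF-subtrees (suc k) {t ∷ s ∷ ss} k< (p ∷ r@(_ ∷ _)) =
    p ∷ attachF-subtrees (suc k) {s ∷ ss} k< r

  gam-β : ∀ {t} i → γ-Domain i t → IsBeta t → IsBeta (gam i t)
  gam-β i _ single = root refl (leaf ∷ [])
  gam-β (suc k) (on-path _ (s≤s _) i≤) (root e r) =
    mkBeta (attachF-≢[] k i≤) (trans (cong suc e) (sym (attachF-sum k i≤)))
      (attachF-subtrees k i≤ r)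

  ∷ʳ-right : ∀ ts → length (rightLabels (ts ∷ʳ •)) ≡ 1
  ∷ʳ-right []           = refl
  ∷ʳ-right (t ∷ [])     = refl
  ∷ʳ-right (t ∷ s ∷ ss) = ∷ʳ-right (s ∷ ss)

  rightLabels-∷ : ∀ t {ts} → NonEmpty ts → rightLabels (t ∷ ts) ≡ rightLabels ts
  rightLabels-∷ _ cons = refl

  attachF-right : ∀ k ts → k < length (rightLabels ts) →
                  length (rightLabels (attachF k ts)) ≡ suc k
  attachF-right zero    ts _ = ∷ʳ-right ts
  attachF-right (suc k) [] ()
  attachF-right (suc k) (node _ us ∷ []) (s≤s k<) = cong suc (attachF-right k us k<)
  attachF-right (suc k) (t ∷ s ∷ ss) k< =
    trans (cong length (rightLabels-∷ t (attachLast-≢[] k s ss)))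
          (attachF-right (suc k) (s ∷ ss) k<)

  gam-rpath : ∀ {t} i → γ-Domain i t → rpath (gam i t) ≡ i
  gam-rpath {node _ []} i (convention _ refl) = refl
  gam-rpath {node _ []} i (on-path _ 1≤i i≤) = ⊥-elim (1+n≰n (≤-trans 1≤i i≤))
  gam-rpath {node _ (t ∷ ts)} (suc k) (on-path _ (s≤s _) i≤) = attachF-right k (t ∷ ts) i≤

  mutual
    ⊘-rpath : ∀ u v → rpath (u ⊘ v) ≡ rpath u + rpath v
    ⊘-rpath (node _ [])       v = refl
    ⊘-rpath (node _ (t ∷ ts)) v = graftLast-right t ts v

    graftLast-right : ∀ t ts v → length (rightLabels (graftLast t ts v)) ≡
                                 length (rightLabels (t ∷ ts)) + rpath v
    graftLast-right (node a [])       [] v = refl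
    graftLast-right (node a (t ∷ ts)) [] v = cong suc (graftLast-right t ts v)
    graftLast-right t (s ∷ ss) v =
      trans (cong length (rightLabels-∷ t (graftLast-≢[] s ss v)))
            (graftLast-right s ss v)

  rpath-pos⇒≢• : ∀ {t} → 1 ≤ rpath t → t ≢ •
  rpath-pos⇒≢• () refl

  mutual
    hF-β : ∀ {ts} → All IsSubtree ts → IsBeta (hF ts)
    hF-β [] = single
    hF-β {node i ts ∷ []} (p ∷ []) = hF-summand p
    hF-β {node i ts ∷ u ∷ us} (p ∷ r@(_ ∷ _)) =
      ⊘-β (hF-≢• r) (rpath-pos⇒≢• (subst (1 ≤_) (sym (gam-rpath i (hF-domain p))) (label-pos p)))
        (hF-β r) (hF-summand p)

    hF-summand : ∀ {i ts} → IsSubtree (node i ts) → IsBeta (gam i (hF ts))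
    hF-summand leaf              = gam-β 1 (convention refl refl) single
    hF-summand p@(inner _ _ r) = gam-β _ (hF-domain p) (hF-β r)

    hF-domain : ∀ {i ts} → IsSubtree (node i ts) → γ-Domain i (hF ts)
    hF-domain leaf = convention refl refl
    hF-domain (inner p q r) = on-path (hF-≢• r) p (subst (_ ≤_) (sym (hF-rpath r)) q)

    hF-≢• : ∀ {t ts} → All IsSubtree (t ∷ ts) → hF (t ∷ ts) ≢ •
    hF-≢• r = rpath-pos⇒≢• (subst (1 ≤_) (sym (hF-rpath r)) (labelSum-pos r))

    hF-rpath : ∀ {t ts} → All IsSubtree (t ∷ ts) → rpath (hF (t ∷ ts)) ≡ labelSum (t ∷ ts)
    hF-rpath {node i ts} (p ∷ []) =
      trans (gam-rpath i (hF-domain p)) (sym (+-identityʳ i))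
    hF-rpath {node i ts} {u ∷ us} (p ∷ r@(_ ∷ _)) =
      trans (⊘-rpath (hF (u ∷ us)) (gam i (hF ts)))
        (trans (cong₂ _+_ (hF-rpath r) (gam-rpath i (hF-domain p)))
               (+-comm (labelSum (u ∷ us)) i))

  mutual
    ⊘-assoc : ∀ u v w → NonEmpty (children v) → (u ⊘ v) ⊘ w ≡ u ⊘ (v ⊘ w)
    ⊘-assoc (node _ []) (node _ (t ∷ ts)) w cons = refl
    ⊘-assoc (node a (t ∷ [])) v w ne =
      cong (λ s → node a (s ∷ [])) (⊘-assoc t v w ne)
    ⊘-assoc (node a (t ∷ s ∷ ss)) v w ne =
      cong (node a) (graftLast-assoc′ a t s ss v w ne)

    graftLast-assoc′ : ∀ a t s ss v w → NonEmpty (children v) →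
      children (node a (t ∷ graftLast s ss v) ⊘ w) ≡ t ∷ graftLast s ss (v ⊘ w)
    graftLast-assoc′ a t s [] v w ne = cong (λ x → t ∷ x ∷ []) (⊘-assoc s v w ne)
    graftLast-assoc′ a t s (s′ ∷ ss) v w ne =
      cong (t ∷_) (graftLast-assoc′ a s s′ ss v w ne)

  hF-++ : ∀ {t ts u us} → All IsSubtree (t ∷ ts) → All IsSubtree (u ∷ us) →
          hF ((t ∷ ts) ++ (u ∷ us)) ≡ hF (u ∷ us) ⊘ hF (t ∷ ts)
  hF-++ {node i xs} {[]} _ _ = refl
  hF-++ {node i xs} {s ∷ ss} {u} {us} (_ ∷ r) r′ =
    trans (cong (_⊘ gam i (hF xs)) (hF-++ r r′))
          (⊘-assoc (hF (u ∷ us)) (hF (s ∷ ss)) (gam i (hF xs)) (non-• (hF-β r) (hF-≢• r)))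

record 𝓑 : Set where
  constructor mk
  field
    tree : Raw.Tree
    isβ  : Raw.IsBeta tree

open 𝓑 public

𝓑-≡ : ∀ {t u : 𝓑} → tree t ≡ tree u → t ≡ u
𝓑-≡ {mk t p} {mk .t q} refl = cong (mk t) (Raw.IsBeta-irr p q)

• : 𝓑
• = mk Raw.• Raw.single

raw-≢• : ∀ {t} → t ≢ • → tree t ≢ Raw.•
raw-≢• t≢• e = t≢• (𝓑-≡ e)

leaves int root rpath sub rsub : 𝓑 → ℕ
leaves t = Raw.leaves (tree t)
int    t = Raw.int (tree t)
root   t = Raw.label (tree t)
rpath  t = Raw.rpath (tree t)
sub    t = Raw.sub (tree t)
rsub   t = Raw.rsub (tree t)

oplus : (u v : 𝓑) → u ≢ • → v ≢ • → 𝓑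
oplus u v p q = mk (tree u Raw.⊕ tree v) (Raw.⊕-β (raw-≢• p) (raw-≢• q) (isβ u) (isβ v))

oslash : (u v : 𝓑) → u ≢ • → v ≢ • → 𝓑
oslash u v p q = mk (tree u Raw.⊘ tree v) (Raw.⊘-β (raw-≢• p) (raw-≢• q) (isβ u) (isβ v))

lam : (i : ℕ) (t : 𝓑) → 1 ≤ i → i ≤ root t → 𝓑
lam i t p q = mk (Raw.lam i (tree t)) (Raw.lam-β i p q (isβ t))

gam : (i : ℕ) (t : 𝓑) → Raw.γ-Domain i (tree t) → 𝓑
gam i t d = mk (Raw.gam i (tree t)) (Raw.gam-β i d (isβ t))

h : 𝓑 → 𝓑
h t = mk (Raw.hF (Raw.children (tree t))) (Raw.hF-β (Raw.subtrees (isβ t)))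

-- Every β(1,0)-tree is •, a lam or an oplus, so h-•, h-lam and h-oplus determine h.

h-• : h • ≡ •
h-• = refl

h-≢• : ∀ t → t ≢ • → h t ≢ •
h-≢• (mk _ Raw.single)     t≢• = λ _ → t≢• refl
h-≢• (mk _ (Raw.root _ r)) _   = λ e → Raw.hF-≢• r (cong tree e)

h-lam : ∀ i t (p : 1 ≤ i) (q : i ≤ root t) →
        Σ (Raw.γ-Domain i (tree (h t))) λ d → h (lam i t p q) ≡ gam i (h t) d
h-lam i (mk _ Raw.single) p q = Raw.convention refl (≤-antisym q p) , 𝓑-≡ refl
h-lam i (mk _ (Raw.root refl r)) p q = Raw.hF-domain (Raw.inner p q r) , 𝓑-≡ refl

h-oplus : ∀ u v (p : u ≢ •) (q : v ≢ •) →
          h (oplus u v p q) ≡ oslash (h v) (h u) (h-≢• v q) (h-≢• u p)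
h-oplus (mk _ Raw.single) _ p _ = ⊥-elim (p refl)
h-oplus (mk _ (Raw.root _ _)) (mk _ Raw.single) _ q = ⊥-elim (q refl)
h-oplus (mk _ (Raw.root refl r)) (mk _ (Raw.root refl s)) p q = 𝓑-≡ (Raw.hF-++ r s)

{-# OPTIONS --safe #-}

-- Everything is read off from the effect of ⊘ and γᵢ on each statistic, mirroring
-- that of ⊕ and λᵢ on the dual one.  Two points are less symmetric:
-- ⊘ concatenates the label sequences of the right paths, because the identified
-- node keeps the label 1 of the rightmost leaf; and γᵢ raises every label on the
-- new right path above 1 except that of the new leaf, so γᵢ t always has rsub 1.

module Submission where

open import Defs using (module Raw)
open import Data.Nat using (ℕ; zero; suc; _+_; _≤_; _<_; s≤s; _≟_)
open import Data.Nat.Properties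
  using (+-suc; +-comm; +-assoc; +-identityʳ; suc-injective)
open import Data.List using (List; []; _∷_; _++_; _∷ʳ_; length; filter)
open import Data.List.Properties using (filter-++; length-++; length-++-comm)
open import Data.List.Relation.Unary.All using (All; []; _∷_)
open import Data.Product using (_×_; _,_)
open import Data.Empty using (⊥-elim)
open import Relation.Binary.PropositionalEquality
  using (_≡_; _≢_; refl; sym; trans; cong; cong₂; subst; module ≡-Reasoning)
open ≡-Reasoning

module RawStatistics where
  open Raw

  ones : List ℕ → ℕ
  ones as = length (filter (_≟ 1) as)

  ones-++ : ∀ as bs → ones (as ++ bs) ≡ ones as + ones bs
  ones-++ as bs = trans (cong length (filter-++ (_≟ 1) as bs)) (length-++ (filter (_≟ 1) as))

  -- `leaves` reduces only on a visible `[]` or cons, and `graftLast` and `attachF` applied to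
  -- variables expose neither; the `NonEmpty` witness unblocks it.
  leaves-node : ∀ {a ts} → NonEmpty ts → leaves (node a ts) ≡ leavesF ts
  leaves-node cons = refl

  int-node : ∀ {a ts} → NonEmpty ts → int (node a ts) ≡ suc (intF ts)
  int-node cons = refl

  -- Effect of `⊘` on the statistics.

  mutual
    -- The rightmost leaf of `u` becomes internal or, if `v` is a single node, merges with that
    -- leaf; either way one leaf is lost. The `suc` avoids truncated subtraction.
    leaves-⊘ : ∀ u v → suc (leaves (u ⊘ v)) ≡ leaves u + leaves v
    leaves-⊘ (node _ [])       (node _ [])      = refl
    leaves-⊘ (node _ [])       (node _ (_ ∷ _)) = refl
    leaves-⊘ (node _ (t ∷ ts)) v =
      trans (cong suc (leaves-node (graftLast-≢[] t ts v))) (leavesF-graftLast t ts v)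

    leavesF-graftLast : ∀ t ts v →
      suc (leavesF (graftLast t ts v)) ≡ leavesF (t ∷ ts) + leaves v
    leavesF-graftLast t [] v = begin
      suc (leaves (t ⊘ v) + 0)  ≡⟨ cong suc (+-identityʳ _) ⟩
      suc (leaves (t ⊘ v))      ≡⟨ leaves-⊘ t v ⟩
      leaves t + leaves v       ≡⟨ cong (_+ leaves v) (+-identityʳ (leaves t)) ⟨
      leaves t + 0 + leaves v   ∎
    leavesF-graftLast t (s ∷ ss) v = begin
      suc (leaves t + leavesF (graftLast s ss v))  ≡⟨ +-suc (leaves t) _ ⟨
      leaves t + suc (leavesF (graftLast s ss v))
        ≡⟨ cong (leaves t +_) (leavesF-graftLast s ss v) ⟩
      leaves t + (leavesF (s ∷ ss) + leaves v)     ≡⟨ +-assoc (leaves t) _ _ ⟨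
      leaves t + leavesF (s ∷ ss) + leaves v       ∎

  mutual
    -- The identified node is internal exactly when the root of `v` is, so it is already counted in
    -- `int v`.
    int-⊘ : ∀ u v → int (u ⊘ v) ≡ int u + int v
    int-⊘ (node _ [])       (node _ [])      = refl
    int-⊘ (node _ [])       (node _ (_ ∷ _)) = refl
    int-⊘ (node _ (t ∷ ts)) v =
      trans (int-node (graftLast-≢[] t ts v)) (cong suc (intF-graftLast t ts v))

    intF-graftLast : ∀ t ts v → intF (graftLast t ts v) ≡ intF (t ∷ ts) + int v
    intF-graftLast t [] v = begin
      int (t ⊘ v) + 0    ≡⟨ +-identityʳ _ ⟩
      int (t ⊘ v)        ≡⟨ int-⊘ t v ⟩
      int t + int v      ≡⟨ cong (_+ int v) (+-identityʳ (int t)) ⟨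
      int t + 0 + int v  ∎
    intF-graftLast t (s ∷ ss) v =
      trans (cong (int t +_) (intF-graftLast s ss v)) (sym (+-assoc (int t) _ _))

  length-graftLast : ∀ t ts v → length (graftLast t ts v) ≡ length (t ∷ ts)
  length-graftLast t []       v = refl
  length-graftLast t (s ∷ ss) v = cong suc (length-graftLast s ss v)

  label-⊘ : ∀ u v → NonEmpty (children u) → label (u ⊘ v) ≡ label u
  label-⊘ (node _ _) v cons = refl

  sub-⊘ : ∀ u v → NonEmpty (children u) → sub (u ⊘ v) ≡ sub u
  sub-⊘ (node _ (t ∷ ts)) v cons = length-graftLast t ts v

  -- `⊘` writes 1 at the identified node; `IsSubtree` ensures that the leaf there had label 1
  -- before, so no entry changes.
  rightLabels-graftLast : ∀ {t ts} v → All IsSubtree (t ∷ ts) →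
    rightLabels (graftLast t ts v) ≡ rightLabels (t ∷ ts) ++ rightLabels (children v)
  rightLabels-graftLast v (leaf ∷ [])                = refl
  rightLabels-graftLast v (inner {a = a} _ _ r ∷ []) = cong (a ∷_) (rightLabels-graftLast v r)
  rightLabels-graftLast {t} {s ∷ ss} v (_ ∷ r@(_ ∷ _)) =
    trans (rightLabels-∷ t (graftLast-≢[] s ss v)) (rightLabels-graftLast v r)

  rsub-⊘ : ∀ u v → NonEmpty (children u) → All IsSubtree (children u) →
           rsub (u ⊘ v) ≡ rsub u + rsub v
  rsub-⊘ (node _ (t ∷ ts)) v cons r =
    trans (cong ones (rightLabels-graftLast v r)) (ones-++ (rightLabels (t ∷ ts)) _)

  -- Effect of `γᵢ` on the statistics.

  leavesF-∷ʳ : ∀ ts → leavesF (ts ∷ʳ •) ≡ suc (leavesF ts)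
  leavesF-∷ʳ []       = refl
  leavesF-∷ʳ (t ∷ ts) = trans (cong (leaves t +_) (leavesF-∷ʳ ts)) (+-suc (leaves t) _)

  intF-∷ʳ : ∀ ts → intF (ts ∷ʳ •) ≡ intF ts
  intF-∷ʳ []       = refl
  intF-∷ʳ (t ∷ ts) = cong (int t +_) (intF-∷ʳ ts)

  rightLabels-∷ʳ : ∀ ts → rightLabels (ts ∷ʳ •) ≡ 1 ∷ []
  rightLabels-∷ʳ []           = refl
  rightLabels-∷ʳ (t ∷ [])     = refl
  rightLabels-∷ʳ (t ∷ s ∷ ss) = rightLabels-∷ʳ (s ∷ ss)

  mutual
    -- The bound makes the node of attachment internal, so the new leaf does not replace an old one.
    -- For the same reason no node becomes internal in `int-attach`.
    leaves-attach : ∀ k {t} → k < rpath t → leaves (attach k t) ≡ suc (leaves t)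
    leaves-attach k {node _ []} ()
    leaves-attach k {node _ (_ ∷ _)} k< =
      trans (leaves-node (attachF-≢[] k k<)) (leavesF-attachF k k<)

    leavesF-attachF : ∀ k {ts} → k < length (rightLabels ts) →
                      leavesF (attachF k ts) ≡ suc (leavesF ts)
    leavesF-attachF zero    {ts} _ = leavesF-∷ʳ ts
    leavesF-attachF (suc k) {[]} ()
    leavesF-attachF (suc k) {t@(node _ _) ∷ []} (s≤s k<) = cong (_+ 0) (leaves-attach k {t} k<)
    leavesF-attachF (suc k) {t ∷ s ∷ ss} k< =
      trans (cong (leaves t +_) (leavesF-attachF (suc k) {s ∷ ss} k<)) (+-suc (leaves t) _)

  mutual
    int-attach : ∀ k {t} → k < rpath t → int (attach k t) ≡ int t
    int-attach k {node _ []} ()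
    int-attach k {node _ (_ ∷ _)} k< =
      trans (int-node (attachF-≢[] k k<)) (cong suc (intF-attachF k k<))

    intF-attachF : ∀ k {ts} → k < length (rightLabels ts) → intF (attachF k ts) ≡ intF ts
    intF-attachF zero    {ts} _ = intF-∷ʳ ts
    intF-attachF (suc k) {[]} ()
    intF-attachF (suc k) {t@(node _ _) ∷ []} (s≤s k<) = cong (_+ 0) (int-attach k {t} k<)
    intF-attachF (suc k) {t ∷ s ∷ ss} k< = cong (int t +_) (intF-attachF (suc k) {s ∷ ss} k<)

  length-attachLast : ∀ k ts → length (attachLast k ts) ≡ length ts
  length-attachLast k []           = refl
  length-attachLast k (t ∷ [])     = refl
  length-attachLast k (t ∷ s ∷ ss) = cong suc (length-attachLast k (s ∷ ss))

  ones-attachF : ∀ k {ts} → k < length (rightLabels ts) → All IsSubtree ts →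
                 ones (rightLabels (attachF k ts)) ≡ 1
  ones-attachF zero {ts} _ _ = cong ones (rightLabels-∷ʳ ts)
  ones-attachF (suc k) () []
  ones-attachF (suc k) (s≤s ()) (leaf ∷ [])
  -- Matching `1 ≤ a` exposes `a` as a successor; the raised label is then at least 2, and the
  -- filter drops it by computation.
  ones-attachF (suc k) (s≤s k<) (inner (s≤s _) _ r ∷ []) = ones-attachF k k< r
  ones-attachF (suc k) {t ∷ s ∷ ss} k< (_ ∷ r@(_ ∷ _)) =
    trans (cong ones (rightLabels-∷ t (attachLast-≢[] k s ss)))
          (ones-attachF (suc k) {s ∷ ss} k< r)

  -- The bounds exclude `•`, where the convention breaks the formula: `gam 1 •` has one leaf, not
  -- two. Leaf summands are therefore treated separately below.
  leaves-gam : ∀ {i} t → 1 ≤ i → i ≤ rpath t → leaves (gam i t) ≡ suc (leaves t)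
  leaves-gam (node _ []) (s≤s _) ()
  leaves-gam {suc k} t@(node _ (_ ∷ _)) (s≤s _) i≤ = leaves-attach k {t} i≤

  int-gam : ∀ {i} t → 1 ≤ i → i ≤ rpath t → int (gam i t) ≡ int t
  int-gam (node _ []) (s≤s _) ()
  int-gam {suc k} t@(node _ (_ ∷ _)) (s≤s _) i≤ = int-attach k {t} i≤

  label-gam : ∀ {i} t → 1 ≤ i → i ≤ rpath t → label (gam i t) ≡ suc (label t)
  label-gam (node _ []) (s≤s _) ()
  label-gam (node _ (_ ∷ _)) _ _ = refl

  -- `ones (i ∷ [])` is the indicator of `i ≡ 1`, the only case in which the new leaf hangs from the
  -- root. This form matches the entry `i` of `rightLabels` on the dual side.
  sub-gam : ∀ {i} t → 1 ≤ i → i ≤ rpath t → sub (gam i t) ≡ ones (i ∷ []) + sub t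
  sub-gam (node _ []) (s≤s _) ()
  sub-gam {suc zero}    (node _ (t ∷ ts)) _ _ = length-++-comm (t ∷ ts) (• ∷ [])
  sub-gam {suc (suc k)} (node _ (t ∷ ts)) _ _ = length-attachLast k (t ∷ ts)

  rsub-gam : ∀ {i} t → γ-Domain i t → All IsSubtree (children t) → rsub (gam i t) ≡ 1
  rsub-gam (node _ []) _ _ = refl
  rsub-gam (node _ (_ ∷ _)) (convention () _)
  rsub-gam {suc k} (node _ (_ ∷ _)) (on-path _ (s≤s _) i≤) r = ones-attachF k i≤ r

  -- Statistics of the image under the recursion.

  hF-nonEmpty : ∀ {t ts} → All IsSubtree (t ∷ ts) → NonEmpty (children (hF (t ∷ ts)))
  hF-nonEmpty r = non-• (hF-β r) (hF-≢• r)

  -- Since `hF` turns the label sum into `rpath`, the label condition on `i` becomes the range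
  -- condition of `γᵢ`.
  ≤-rpath-hF : ∀ {i t ts} → All IsSubtree (t ∷ ts) → i ≤ labelSum (t ∷ ts) →
               i ≤ rpath (hF (t ∷ ts))
  ≤-rpath-hF r = subst (_ ≤_) (sym (hF-rpath r))

  mutual
    int-hF : ∀ {t ts} → All IsSubtree (t ∷ ts) → int (hF (t ∷ ts)) ≡ leavesF (t ∷ ts)
    int-hF {node _ _} (p ∷ []) = trans (int-hF-summand p) (sym (+-identityʳ _))
    int-hF {node i ts} {u ∷ us} (p ∷ r@(_ ∷ _)) = begin
      int (hF (u ∷ us) ⊘ gam i (hF ts))        ≡⟨ int-⊘ (hF (u ∷ us)) _ ⟩
      int (hF (u ∷ us)) + int (gam i (hF ts))  ≡⟨ cong₂ _+_ (int-hF r) (int-hF-summand p) ⟩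
      leavesF (u ∷ us) + leaves (node i ts)    ≡⟨ +-comm (leavesF (u ∷ us)) _ ⟩
      leaves (node i ts) + leavesF (u ∷ us)    ∎

    int-hF-summand : ∀ {i ts} → IsSubtree (node i ts) →
                     int (gam i (hF ts)) ≡ leaves (node i ts)
    int-hF-summand leaf = refl
    int-hF-summand (inner {t = t} {ts} p q r) =
      trans (int-gam (hF (t ∷ ts)) p (≤-rpath-hF r q)) (int-hF r)

  mutual
    leaves-hF : ∀ {t ts} → All IsSubtree (t ∷ ts) →
                leaves (hF (t ∷ ts)) ≡ suc (intF (t ∷ ts))
    leaves-hF {node _ _} (p ∷ []) =
      trans (leaves-hF-summand p) (cong suc (sym (+-identityʳ _)))
    -- Each summand of a sum has its own root, hence two `suc`s; `⊕` merges the roots while `⊘`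
    -- loses a leaf, and `suc-injective` cancels one on both sides.
    leaves-hF {node i ts} {u ∷ us} (p ∷ r@(_ ∷ _)) = suc-injective (begin
      suc (leaves (hF (u ∷ us) ⊘ gam i (hF ts)))     ≡⟨ leaves-⊘ (hF (u ∷ us)) _ ⟩
      leaves (hF (u ∷ us)) + leaves (gam i (hF ts))
        ≡⟨ cong₂ _+_ (leaves-hF r) (leaves-hF-summand p) ⟩
      suc (intF (u ∷ us)) + suc (int (node i ts))    ≡⟨ +-comm (suc (intF (u ∷ us))) _ ⟩
      suc (int (node i ts)) + suc (intF (u ∷ us))    ≡⟨ cong suc (+-suc (int (node i ts)) _) ⟩
      suc (suc (int (node i ts) + intF (u ∷ us)))    ∎)

    leaves-hF-summand : ∀ {i ts} → IsSubtree (node i ts) →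
                        leaves (gam i (hF ts)) ≡ suc (int (node i ts))
    leaves-hF-summand leaf = refl
    leaves-hF-summand (inner {t = t} {ts} p q r) =
      trans (leaves-gam (hF (t ∷ ts)) p (≤-rpath-hF r q)) (cong suc (leaves-hF r))

  -- Since `⊘` reverses the order, the root of the image comes from the last summand, just as
  -- `rightLabels` follows only the last subtree. The same holds for `sub-hF`.
  label-hF : ∀ {t ts} → All IsSubtree (t ∷ ts) →
             label (hF (t ∷ ts)) ≡ length (rightLabels (t ∷ ts))
  label-hF (leaf ∷ []) = refl
  label-hF (inner {t = t} {ts} p q r ∷ []) =
    trans (label-gam (hF (t ∷ ts)) p (≤-rpath-hF r q)) (cong suc (label-hF r))
  label-hF {node _ _} {u ∷ us} (_ ∷ r@(_ ∷ _)) =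
    trans (label-⊘ (hF (u ∷ us)) _ (hF-nonEmpty r)) (label-hF r)

  sub-hF : ∀ {t ts} → All IsSubtree (t ∷ ts) →
           sub (hF (t ∷ ts)) ≡ ones (rightLabels (t ∷ ts))
  sub-hF (leaf ∷ []) = refl
  sub-hF (inner {i} {t} {ts} p q r ∷ []) =
    trans (sub-gam (hF (t ∷ ts)) p (≤-rpath-hF r q))
      (trans (cong (ones (i ∷ []) +_) (sub-hF r)) (sym (ones-++ (i ∷ []) _)))
  sub-hF {node _ _} {u ∷ us} (_ ∷ r@(_ ∷ _)) =
    trans (sub-⊘ (hF (u ∷ us)) _ (hF-nonEmpty r)) (sub-hF r)

  rsub-hF-summand : ∀ {i ts} → IsSubtree (node i ts) → rsub (gam i (hF ts)) ≡ 1
  rsub-hF-summand leaf = refl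
  rsub-hF-summand p@(inner {t = t} {ts} _ _ r) =
    rsub-gam (hF (t ∷ ts)) (hF-domain p) (subtrees (hF-β r))

  -- Each subtree at the root contributes one factor with `rsub` 1, and `rsub` is additive under
  -- `⊘`.
  rsub-hF : ∀ {ts} → All IsSubtree ts → rsub (hF ts) ≡ length ts
  rsub-hF [] = refl
  rsub-hF {node _ _ ∷ []} (p ∷ []) = rsub-hF-summand p
  rsub-hF {node i ts ∷ u ∷ us} (p ∷ r@(_ ∷ _)) = begin
    rsub (hF (u ∷ us) ⊘ gam i (hF ts))
      ≡⟨ rsub-⊘ (hF (u ∷ us)) _ (hF-nonEmpty r) (subtrees (hF-β r)) ⟩
    rsub (hF (u ∷ us)) + rsub (gam i (hF ts))  ≡⟨ cong₂ _+_ (rsub-hF r) (rsub-hF-summand p) ⟩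
    length (u ∷ us) + 1                        ≡⟨ +-comm _ 1 ⟩
    suc (length (u ∷ us))                      ∎

open RawStatistics
open import Defs

theorem6 : (t : 𝓑) → t ≢ • →
    (leaves t ≡ int (h t)) × (int t ≡ leaves (h t)) ×
    (root t ≡ rpath (h t)) × (rpath t ≡ root (h t)) ×
    (sub t ≡ rsub (h t)) × (rsub t ≡ sub (h t))
theorem6 (mk _ Raw.single) t≢• = ⊥-elim (t≢• refl)
theorem6 (mk _ (Raw.root label≡ r)) _ =
  sym (int-hF r) , sym (leaves-hF r) ,
  -- Here the equality required of the root label enters: `hF` sees only the subtrees, so `hF-rpath`
  -- yields their label sum.
  trans label≡ (sym (Raw.hF-rpath r)) , sym (label-hF r) ,
  sym (rsub-hF r) , sym (sub-hF r)
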